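{- Let $Ax\in\{(\mathrm{ciw}),(\mathrm{ci}),(\mathrm{cl}),(\mathrm{cf}),(d1),(d2),(\mathrm{a}_\circ)\}$ and let $\varphi\in\mathrm{For}(\Sigma)$. If $\nvdash_{\mathrm{RmbC}(Ax)}\varphi$, then there exist a finite BALFI $\mathbf{A}\in\mathsf{BI}(Ax)$ and a valuation $v:\mathrm{For}(\Sigma)\to A$ such that $v(\varphi)\neq 1$.
   Context: $\mathrm{For}(\Sigma)$ is the set of formulas built from a countably infinite set of propositional variables using binary $\wedge,\vee,\to$ and unary $\neg,\circ$; $\alpha\leftrightarrow\beta$ abbreviates $(\alpha\to\beta)\wedge(\beta\to\alpha)$. The logic $\mathrm{RmbC}$ is given by the Hilbert calculus with axiom schemas $\alpha\to(\beta\to\alpha)$; $(\alpha\to(\beta\to\gamma))\to((\alpha\to\beta)\to(\alpha\to\gamma))$; $\alpha\to(\beta\to(\alpha\wedge\beta))$; $(\alpha\wedge\beta)\to\alpha$; $(\alpha\wedge\beta)\to\beta$; $\alpha\to(\alpha\vee\beta)$; $\beta\to(\alpha\vee\beta)$; $(\alpha\to\gamma)\to((\beta\to\gamma)\to((\alpha\vee\beta)\to\gamma))$; $(\alpha\to\beta)\vee\alpha$; $\alpha\vee\neg\alpha$; $\circ\alpha\to(\alpha\to(\neg\alpha\to\beta))$; and inference rules: modus ponens; $(R_\neg)$: from $\alpha\leftrightarrow\psi$ infer $\neg\alpha\leftrightarrow\neg\psi$; $(R_\circ)$: from $\alpha\leftrightarrow\psi$ infer $\circ\alpha\leftrightarrow\circ\psi$.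 $\mathrm{RmbC}(Ax)$ is obtained by adding the axiom schema $Ax$ to this calculus, and $\vdash_{\mathrm{RmbC}(Ax)}\varphi$ means $\varphi$ is derivable in it (without premises). A BALFI is an algebra $\mathbf{B}=\langle B,\wedge,\vee,\to,\neg,\circ,0,1\rangle$ such that $\langle B,\wedge,\vee,\to,0,1\rangle$ is a Boolean algebra (with complement denoted ${\sim}$) and, for every $a\in B$, $a\vee\neg a=1$ and $a\wedge\neg a\wedge\circ a=0$. A valuation over $\mathbf{B}$ is a homomorphism $v:\mathrm{For}(\Sigma)\to B$. $\mathsf{BI}(Ax)$ is the class of BALFIs validating $Ax$ (every instance takes value $1$ under every valuation). The schemas, with the equivalent equations on BALFIs (for all $a$), are: - $(\mathrm{ciw})$: $\circ\alpha\vee(\alpha\wedge\neg\alpha)$; equation $\circ a={\sim}(a\wedge\neg a)$; - $(\mathrm{ci})$: $\neg{\circ}\alpha\to(\alpha\wedge\neg\alpha)$; equation $\neg(\circ a)=a\wedge\neg a$; - $(\mathrm{cl})$: $\neg(\alpha\wedge\neg\alpha)\to\circ\alpha$; equation $\circ a=\neg(a\wedge\neg a)$; - $(\mathrm{cf})$: $\neg\neg\alpha\to\alpha$; equation $a\wedge\neg\neg a=\neg\neg a$; - $(d1)$: $\circ\alpha\vee\alpha$; equation $\circ a\vee a=1$; - $(d2)$: $\circ\alpha\vee\neg\alpha$; equation $\circ a\vee\neg a=1$; - $(\mathrm{a}_\circ)$: $\circ{\circ}\alpha$; equation $\circ{\circ}a=1$. -}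

module Defs where

open import Algebra.Core using (Op₁; Op₂)
open import Algebra.Definitions using (Congruent₁)
open import Algebra.Lattice.Bundles using (BooleanAlgebra)
open import Data.Fin.Base using (Fin)
open import Data.Nat.Base using (ℕ)
open import Data.Product.Base using (∃-syntax)
open import Function.Bundles using (Inverse)
open import Level using (Level; _⊔_) renaming (suc to lsuc)
open import Relation.Binary.PropositionalEquality.Properties using (setoid)

infix  10 ¬̇_ ∘̇_
infixr 9 _∧̇_
infixr 8 _∨̇_
infixr 7 _→̇_
infix  6 _↔̇_

data For : Set where
  var  : ℕ → For
  _∧̇_ : For → For → For
  _∨̇_ : For → For → For
  _→̇_ : For → For → For
  ¬̇_  : For → For
  ∘̇_  : For → For

_↔̇_ : For → For → For
α ↔̇ β = (α →̇ β) ∧̇ (β →̇ α)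

data Schema : Set where
  ciw ci cl cf d1 d2 a∘ : Schema

-- Every one of these schemas has a single metavariable.
instantiate : Schema → For → For
instantiate ciw α = ∘̇ α ∨̇ (α ∧̇ ¬̇ α)
instantiate ci  α = ¬̇ ∘̇ α →̇ (α ∧̇ ¬̇ α)
instantiate cl  α = ¬̇ (α ∧̇ ¬̇ α) →̇ ∘̇ α
instantiate cf  α = ¬̇ ¬̇ α →̇ α
instantiate d1  α = ∘̇ α ∨̇ α
instantiate d2  α = ∘̇ α ∨̇ ¬̇ α
instantiate a∘  α = ∘̇ ∘̇ α

infix 4 RmbC[_]⊢_

-- Derivability without premises, so R¬ and R∘ apply to theorems only.
data RmbC[_]⊢_ (Ax : Schema) : For → Set where
  K     : ∀ α β → RmbC[ Ax ]⊢ α →̇ (β →̇ α)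
  S     : ∀ α β γ → RmbC[ Ax ]⊢ (α →̇ (β →̇ γ)) →̇ ((α →̇ β) →̇ (α →̇ γ))
  ∧-I   : ∀ α β → RmbC[ Ax ]⊢ α →̇ (β →̇ (α ∧̇ β))
  ∧-E₁  : ∀ α β → RmbC[ Ax ]⊢ (α ∧̇ β) →̇ α
  ∧-E₂  : ∀ α β → RmbC[ Ax ]⊢ (α ∧̇ β) →̇ β
  ∨-I₁  : ∀ α β → RmbC[ Ax ]⊢ α →̇ (α ∨̇ β)
  ∨-I₂  : ∀ α β → RmbC[ Ax ]⊢ β →̇ (α ∨̇ β)
  ∨-E   : ∀ α β γ → RmbC[ Ax ]⊢ (α →̇ γ) →̇ ((β →̇ γ) →̇ ((α ∨̇ β) →̇ γ))
  →∨    : ∀ α β → RmbC[ Ax ]⊢ (α →̇ β) ∨̇ α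
  em    : ∀ α → RmbC[ Ax ]⊢ α ∨̇ ¬̇ α
  bc    : ∀ α β → RmbC[ Ax ]⊢ ∘̇ α →̇ (α →̇ (¬̇ α →̇ β))
  extra : ∀ α → RmbC[ Ax ]⊢ instantiate Ax α
  MP    : ∀ {α β} → RmbC[ Ax ]⊢ α →̇ β → RmbC[ Ax ]⊢ α → RmbC[ Ax ]⊢ β
  R¬    : ∀ {α ψ} → RmbC[ Ax ]⊢ α ↔̇ ψ → RmbC[ Ax ]⊢ ¬̇ α ↔̇ ¬̇ ψ
  R∘    : ∀ {α ψ} → RmbC[ Ax ]⊢ α ↔̇ ψ → RmbC[ Ax ]⊢ ∘̇ α ↔̇ ∘̇ ψ

-- The complement of the underlying Boolean algebra is ∼; ¬ is the (weaker)
-- paraconsistent negation. The library's Boolean algebras have no implication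
-- in their signature, so it is added here with its defining law. The
-- congruence fields say that ¬ and ∘ are operations on the carrier setoid.
record BALFI (c ℓ : Level) : Set (lsuc (c ⊔ ℓ)) where
  infixr 5 _⇒_
  infix  8 ¬_ ○_
  field
    booleanAlgebra : BooleanAlgebra c ℓ

  open BooleanAlgebra booleanAlgebra public
    hiding (¬-cong)
    renaming (¬_ to ∼_; setoid to carrierSetoid)

  field
    _⇒_    : Op₂ Carrier
    ¬_     : Op₁ Carrier
    ○_     : Op₁ Carrier
    ¬-cong : Congruent₁ _≈_ ¬_
    ○-cong : Congruent₁ _≈_ ○_
    ⇒-def  : ∀ a b → (a ⇒ b) ≈ ((∼ a) ∨ b)
    ¬-em   : ∀ a → (a ∨ (¬ a)) ≈ ⊤
    ○-law  : ∀ a → ((a ∧ (¬ a)) ∧ (○ a)) ≈ ⊥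

record Valuation {c ℓ} (B : BALFI c ℓ) : Set (c ⊔ ℓ) where
  open BALFI B
  field
    value  : For → Carrier
    ∧-homo : ∀ α β → value (α ∧̇ β) ≈ (value α ∧ value β)
    ∨-homo : ∀ α β → value (α ∨̇ β) ≈ (value α ∨ value β)
    →-homo : ∀ α β → value (α →̇ β) ≈ (value α ⇒ value β)
    ¬-homo : ∀ α → value (¬̇ α) ≈ (¬ value α)
    ∘-homo : ∀ α → value (∘̇ α) ≈ (○ value α)

open Valuation public using (value)

BI : ∀ {c ℓ} → Schema → BALFI c ℓ → Set (c ⊔ ℓ)
BI Ax B = ∀ (v : Valuation B) (α : For) → value v (instantiate Ax α) ≈ ⊤
  where open BALFI B

Finite : ∀ {c ℓ} → BALFI c ℓ → Set (c ⊔ ℓ)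
Finite B = ∃[ n ] Inverse (BALFI.carrierSetoid B) (setoid (Fin n))

{-# OPTIONS --safe #-}

-- Let M be a finite subformula-closed set containing φ. Over truth assignments
-- ("worlds") to M, ¬M, ¬¬M, ∘M and ∘¬M whose diagram is consistent, a Boolean
-- combination of these formulas is provable iff it holds everywhere, so the
-- powerset of the consistent worlds carries partial operations ⟦α⟧ ↦ ⟦¬α⟧ and
-- ⟦α⟧ ↦ ⟦∘α⟧ for α in M. Off the values of M, the defaults ¬a = ∼a and ∘a = 1
-- make them total and yield a BALFI in BI(Ax) for every schema except cf, which
-- needs ¬¬a ≤ a. For cf the algebra is embedded diagonally in its square, where
-- a value b = ⟦¬α⟧ outside M can be given the negation (∼b, ⟦¬¬α⟧); the first
-- component of this pair recovers b, so its own negation can be set to b.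
--
-- Provability is not known to be decidable here. Whether a set of worlds works
-- depends only on finitely many equations between values, so a suitable set,
-- which cannot fail to exist, is found by search.
module Submission where

open import Defs
open import Algebra.Core using (Op₁; Op₂)
open import Algebra.Lattice.Bundles using (BooleanAlgebra)
open import Algebra.Lattice.Structures using (IsBooleanAlgebra)
open import Algebra.Lattice.Structures.Biased
  using (isDistributiveLatticeʳʲᵐ; isBooleanAlgebraʳ)
import Algebra.Lattice.Properties.BooleanAlgebra as BooleanAlgebraProperties
open import Data.Bool.Base using (Bool; true; false; not; _∧_; _∨_)
import Data.Bool.Properties as Bool
open import Data.Fin.Base using (Fin)
open import Data.Fin.Properties using (*↔×; 2↔Bool; 1↔⊤)
open import Data.Fin.Subset using (Subset; ∁; _∪_; ⊥)
open import Data.Fin.Subset.Properties using (∪-∩-isBooleanAlgebra)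
open import Data.List.Base using (List; []; _∷_; _++_; map; concatMap; length; filter)
open import Data.List.Membership.Propositional using (_∈_; lose; find)
open import Data.List.Membership.Propositional.Properties
  using (∈-map⁺; ∈-map⁻; ∈-++⁺ˡ; ∈-++⁺ʳ; ∈-concatMap⁺; ∈-filter⁺; ∈-filter⁻)
open import Data.List.Relation.Binary.Subset.Propositional using (_⊆_)
open import Data.List.Relation.Unary.All as All using (All; []; _∷_)
open import Data.List.Relation.Unary.All.Properties using (++⁺)
open import Data.List.Relation.Unary.Any using (here; there; any?)
open import Data.Nat.Base using (ℕ; zero; suc; _^_)
import Data.Nat.Properties as ℕ
open import Data.Product.Base using (Σ; ∃; _×_; _,_; proj₁; proj₂; map₂)
open import Data.Product.Properties using (≡-dec)
open import Data.Product.Function.NonDependent.Propositional using (_×-↔_)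
open import Data.Sum.Base using (_⊎_; inj₁; inj₂; [_,_]′)
open import Data.Unit.Base using (tt)
open import Data.Vec.Base as Vec using ([]; _∷_)
import Data.Vec.Properties as Vec
open import Function.Base using (_∘_; id)
open import Function.Bundles using (_↔_; mk↔ₛ′; Inverse)
open import Function.Properties.Inverse using (↔-sym; ↔-trans)
open import Level using (0ℓ)
open import Relation.Binary.Definitions using (DecidableEquality)
open import Relation.Binary.PropositionalEquality
  using (_≡_; _≢_; refl; sym; trans; cong; cong₂; subst)
open import Relation.Binary.PropositionalEquality.Properties using (isEquivalence)
open import Relation.Nullary.Decidable using (Dec; yes; no; map′; _×-dec_; _→-dec_; ¬?)
open import Relation.Nullary.Negation.Core using (¬_; contradiction)

-- Decidable equality of formulas.

-- Comparing codes avoids the thirty off-diagonal cases of equality on For.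
data Code : Set where
  leaf : ℕ → Code
  node : ℕ → Code → Code → Code

_≟ᶜ_ : DecidableEquality Code
leaf m     ≟ᶜ leaf n        = map′ (cong leaf) (λ { refl → refl }) (m ℕ.≟ n)
leaf _     ≟ᶜ node _ _ _    = no λ ()
node _ _ _ ≟ᶜ leaf _        = no λ ()
node m s t ≟ᶜ node n s′ t′  =
  map′ (λ { (refl , refl , refl) → refl }) (λ { refl → refl , refl , refl })
       (m ℕ.≟ n ×-dec s ≟ᶜ s′ ×-dec t ≟ᶜ t′)

encode : For → Code
encode (var n)  = leaf n
encode (α ∧̇ β) = node 0 (encode α) (encode β)
encode (α ∨̇ β) = node 1 (encode α) (encode β)
encode (α →̇ β) = node 2 (encode α) (encode β)
encode (¬̇ α)   = node 3 (encode α) (leaf 0)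
encode (∘̇ α)   = node 4 (encode α) (leaf 0)

decode : Code → For
decode (leaf n)     = var n
decode (node 0 s t) = decode s ∧̇ decode t
decode (node 1 s t) = decode s ∨̇ decode t
decode (node 2 s t) = decode s →̇ decode t
decode (node 3 s _) = ¬̇ decode s
decode (node _ s _) = ∘̇ decode s

decode-encode : ∀ α → decode (encode α) ≡ α
decode-encode (var n)  = refl
decode-encode (α ∧̇ β) = cong₂ _∧̇_ (decode-encode α) (decode-encode β)
decode-encode (α ∨̇ β) = cong₂ _∨̇_ (decode-encode α) (decode-encode β)
decode-encode (α →̇ β) = cong₂ _→̇_ (decode-encode α) (decode-encode β)
decode-encode (¬̇ α)   = cong ¬̇_ (decode-encode α)
decode-encode (∘̇ α)   = cong ∘̇_ (decode-encode α)

infix 4 _≟ᶠ_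

_≟ᶠ_ : DecidableEquality For
α ≟ᶠ β = map′ encode-injective (cong encode) (encode α ≟ᶜ encode β)
  where
  encode-injective : encode α ≡ encode β → α ≡ β
  encode-injective p = trans (sym (decode-encode α)) (trans (cong decode p) (decode-encode β))

-- Subformulas and Boolean combinations.

-- The signature has no falsum; a gentle contradiction, which entails everything by `bc`, takes its
-- place.
⊥̇ ⊤̇ : For
⊥̇ = (var 0 ∧̇ ¬̇ var 0) ∧̇ ∘̇ var 0
⊤̇ = ⊥̇ →̇ ⊥̇

sub : For → List For
sub (var n)  = var n ∷ []
sub (α ∧̇ β) = (α ∧̇ β) ∷ sub α ++ sub β
sub (α ∨̇ β) = (α ∨̇ β) ∷ sub α ++ sub β
sub (α →̇ β) = (α →̇ β) ∷ sub α ++ sub β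
sub (¬̇ α)   = ¬̇ α ∷ sub α
sub (∘̇ α)   = ∘̇ α ∷ sub α

self∈sub : ∀ α → α ∈ sub α
self∈sub (var n)  = here refl
self∈sub (α ∧̇ β) = here refl
self∈sub (α ∨̇ β) = here refl
self∈sub (α →̇ β) = here refl
self∈sub (¬̇ α)   = here refl
self∈sub (∘̇ α)   = here refl

-- Boolean combinations of atoms. Negations of members of M are allowed under ¬
-- and ∘ because the treatment of cf refers to ¬¬α for α in M.
data Over (M : List For) : For → Set where
  var  : ∀ {n} → var n ∈ M → Over M (var n)
  _∧̇_ : ∀ {α β} → Over M α → Over M β → Over M (α ∧̇ β)
  _∨̇_ : ∀ {α β} → Over M α → Over M β → Over M (α ∨̇ β)
  _→̇_ : ∀ {α β} → Over M α → Over M β → Over M (α →̇ β)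
  ¬̇_  : ∀ {α} → α ∈ M ++ map ¬̇_ M → Over M (¬̇ α)
  ∘̇_  : ∀ {α} → α ∈ M ++ map ¬̇_ M → Over M (∘̇ α)

sub-binary : ∀ {M γ} α β → γ ∷ (sub α ++ sub β) ⊆ M → sub α ⊆ M × sub β ⊆ M
sub-binary α β s = s ∘ there ∘ ∈-++⁺ˡ , s ∘ there ∘ ∈-++⁺ʳ (sub α)

mutual
  over : ∀ {M} α → sub α ⊆ M → Over M α
  over α s = All.lookup (all-over α s) (self∈sub α)

  all-over : ∀ {M} α → sub α ⊆ M → All (Over M) (sub α)
  all-over (var n)  s = var (s (here refl)) ∷ []
  all-over (α ∧̇ β) s with sα , sβ ← sub-binary {γ = α ∧̇ β} α β s =
    (over α sα ∧̇ over β sβ) ∷ ++⁺ (all-over α sα) (all-over β sβ)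
  all-over (α ∨̇ β) s with sα , sβ ← sub-binary {γ = α ∨̇ β} α β s =
    (over α sα ∨̇ over β sβ) ∷ ++⁺ (all-over α sα) (all-over β sβ)
  all-over (α →̇ β) s with sα , sβ ← sub-binary {γ = α →̇ β} α β s =
    (over α sα →̇ over β sβ) ∷ ++⁺ (all-over α sα) (all-over β sβ)
  all-over (¬̇ α)   s =
    (¬̇ ∈-++⁺ˡ (s (there (self∈sub α)))) ∷ all-over α (s ∘ there)
  all-over (∘̇ α)   s =
    (∘̇ ∈-++⁺ˡ (s (there (self∈sub α)))) ∷ all-over α (s ∘ there)

-- Compound members of `M` receive guessed values too. When they are Boolean combinations over `M`,
-- a guess that disagrees with `eval` makes the diagram inconsistent, so such a world is discarded
-- with the other inconsistent ones.
atoms : List For → List For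
atoms M = M ++ map ¬̇_ (M ++ map ¬̇_ M) ++ map ∘̇_ (M ++ map ¬̇_ M)

-- Truth assignments and their diagrams.

World : Set
World = For → Bool

eval : World → For → Bool
eval w (var n)  = w (var n)
eval w (α ∧̇ β) = eval w α ∧ eval w β
eval w (α ∨̇ β) = eval w α ∨ eval w β
eval w (α →̇ β) = not (eval w α) ∨ eval w β
eval w (¬̇ α)   = w (¬̇ α)
eval w (∘̇ α)   = w (∘̇ α)

_[_≔_] : World → For → Bool → World
(w [ α ≔ b ]) β with α ≟ᶠ β
... | yes _ = b
... | no  _ = w β

worlds : List For → List World
worlds []       = (λ _ → false) ∷ []
worlds (α ∷ αs) = concatMap (λ w → w [ α ≔ true ] ∷ w [ α ≔ false ] ∷ []) (worlds αs)

lit : Bool → For → For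
lit true  α = α
lit false α = α →̇ ⊥̇

diagram : World → List For → List For
diagram w = map λ α → lit (w α) α

-- An inclusion suffices for weakening and survives repetitions: if `α` recurs in `αs`, its updated
-- literal is again `lit b α`.
diagram-update : ∀ w α b αs →
  diagram (w [ α ≔ b ]) (α ∷ αs) ⊆ lit b α ∷ diagram w αs
diagram-update w α b αs p with ∈-map⁻ (λ β → lit ((w [ α ≔ b ]) β) β) p
... | β , β∈ , refl with α ≟ᶠ β | β∈
...   | yes refl | _         = here refl
...   | no _     | there β∈′ = there (∈-map⁺ (λ γ → lit (w γ) γ) β∈′)
...   | no α≢β   | here refl = contradiction refl α≢β

eval-↔ : ∀ w α β → eval w (α ↔̇ β) ≡ true → eval w α ≡ eval w β
eval-↔ w α β p with eval w α | eval w β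
... | true  | true  = refl
... | false | false = refl

↔-eval : ∀ w α β → eval w α ≡ eval w β → eval w (α ↔̇ β) ≡ true
↔-eval w α β p rewrite p with eval w β
... | true  = refl
... | false = refl

-- Derivation from hypotheses and completeness over consistent worlds.

module Calculus (Ax : Schema) where

  infix 4 _⊢_

  -- `R¬` and `R∘` enter only through `thm`, hence never act on hypotheses; this is what makes the
  -- deduction theorem `lam` hold.
  data _⊢_ (Δ : List For) : For → Set where
    hyp : ∀ {α} → α ∈ Δ → Δ ⊢ α
    thm : ∀ {α} → RmbC[ Ax ]⊢ α → Δ ⊢ α
    mp  : ∀ {α β} → Δ ⊢ α →̇ β → Δ ⊢ α → Δ ⊢ β

  private variable
    Δ Δ′ : List For
    α β γ : For

  weaken : Δ ⊆ Δ′ → Δ ⊢ α → Δ′ ⊢ α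
  weaken s (hyp p)  = hyp (s p)
  weaken s (thm t)  = thm t
  weaken s (mp d e) = mp (weaken s d) (weaken s e)

  theorem : [] ⊢ α → RmbC[ Ax ]⊢ α
  theorem (thm t)  = t
  theorem (mp d e) = MP (theorem d) (theorem e)

  lam : α ∷ Δ ⊢ β → Δ ⊢ α →̇ β
  lam {α} (hyp (here refl)) = mp (mp (thm (S α (α →̇ α) α)) (thm (K α (α →̇ α)))) (thm (K α α))
  lam (hyp (there p)) = mp (thm (K _ _)) (hyp p)
  lam (thm t)         = mp (thm (K _ _)) (thm t)
  lam (mp d e)        = mp (mp (thm (S _ _ _)) (lam d)) (lam e)

  #0 : α ∷ Δ ⊢ α
  #0 = hyp (here refl)

  pair : Δ ⊢ α → Δ ⊢ β → Δ ⊢ α ∧̇ β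
  pair d e = mp (mp (thm (∧-I _ _)) d) e

  fst : Δ ⊢ α ∧̇ β → Δ ⊢ α
  fst = mp (thm (∧-E₁ _ _))

  snd : Δ ⊢ α ∧̇ β → Δ ⊢ β
  snd = mp (thm (∧-E₂ _ _))

  inl : Δ ⊢ α → Δ ⊢ α ∨̇ β
  inl = mp (thm (∨-I₁ _ _))

  inr : Δ ⊢ β → Δ ⊢ α ∨̇ β
  inr = mp (thm (∨-I₂ _ _))

  cases : Δ ⊢ α ∨̇ β → α ∷ Δ ⊢ γ → β ∷ Δ ⊢ γ → Δ ⊢ γ
  cases d e f = mp (mp (mp (thm (∨-E _ _ _)) (lam e)) (lam f)) d

  gentle-explosion : Δ ⊢ (α ∧̇ ¬̇ α) ∧̇ ∘̇ α → Δ ⊢ β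
  gentle-explosion d = mp (mp (mp (thm (bc _ _)) (snd d)) (fst (fst d))) (snd (fst d))

  explode : Δ ⊢ ⊥̇ → Δ ⊢ β
  explode = gentle-explosion

  -- `→∨` with consequent `⊥̇` is excluded middle for the classical negation `α →̇ ⊥̇`.
  classical : α ∷ Δ ⊢ γ → (α →̇ ⊥̇) ∷ Δ ⊢ γ → Δ ⊢ γ
  classical d e = cases (thm (→∨ _ ⊥̇)) e d

  iff : α ∷ Δ ⊢ β → β ∷ Δ ⊢ α → Δ ⊢ α ↔̇ β
  iff d e = pair (lam d) (lam e)

  to : Δ ⊢ α ↔̇ β → Δ ⊢ α → Δ ⊢ β
  to d = mp (fst d)

  from : Δ ⊢ α ↔̇ β → Δ ⊢ β → Δ ⊢ α
  from d = mp (snd d)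

  -- Kalmár's lemma, with formulas under `¬̇` and `∘̇` treated as atoms.
  diagram-decides : ∀ {M} w → Over M α → diagram w (atoms M) ⊢ lit (eval w α) α
  diagram-decides {M = M} w = go
    where
    atom : ∀ {α} → α ∈ atoms M → diagram w (atoms M) ⊢ lit (w α) α
    atom p = hyp (∈-map⁺ (λ α → lit (w α) α) p)

    go : ∀ {α} → Over M α → diagram w (atoms M) ⊢ lit (eval w α) α
    go (var p) = atom (∈-++⁺ˡ p)
    go (¬̇ p)   = atom (∈-++⁺ʳ M (∈-++⁺ˡ (∈-map⁺ ¬̇_ p)))
    go (∘̇ p)   = atom (∈-++⁺ʳ M (∈-++⁺ʳ (map ¬̇_ (M ++ map ¬̇_ M)) (∈-map⁺ ∘̇_ p)))
    go (_∧̇_ {α} {β} o o′) with eval w α | eval w β | go o | go o′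
    ... | true  | true  | d | e = pair d e
    ... | true  | false | d | e = lam (mp (weaken there e) (snd #0))
    ... | false | _     | d | e = lam (mp (weaken there d) (fst #0))
    go (_∨̇_ {α} {β} o o′) with eval w α | eval w β | go o | go o′
    ... | true  | _     | d | e = inl d
    ... | false | true  | d | e = inr e
    ... | false | false | d | e =
      lam (cases #0 (mp (weaken (there ∘ there) d) #0) (mp (weaken (there ∘ there) e) #0))
    go (_→̇_ {α} {β} o o′) with eval w α | eval w β | go o | go o′
    ... | true  | true  | d | e = lam (weaken there e)
    ... | true  | false | d | e = lam (mp (weaken there e) (mp #0 (weaken there d)))
    ... | false | _     | d | e = lam (explode (mp (weaken there d) #0))

  -- The second half of Kalmár's argument: the literals are discharged one atom at a time by
  -- `classical`.
  worlds-exhaustive : ∀ αs → (∀ {w} → w ∈ worlds αs → diagram w αs ⊢ γ) → [] ⊢ γ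
  worlds-exhaustive []       h = h (here refl)
  worlds-exhaustive (α ∷ αs) h = worlds-exhaustive αs λ {w} p →
    classical (branch w true p (here refl)) (branch w false p (there (here refl)))
    where
    extensions : World → List World
    extensions w = w [ α ≔ true ] ∷ w [ α ≔ false ] ∷ []

    branch : ∀ w b → w ∈ worlds αs → w [ α ≔ b ] ∈ extensions w → lit b α ∷ diagram w αs ⊢ _
    branch w b p q = weaken (diagram-update w α b αs)
      (h (∈-concatMap⁺ extensions (lose p q)))

  -- `ws` stands for the consistent worlds. The disjunction in `complete` amounts to deciding
  -- consistency, so it is an assumption here and is met later only under a double negation.
  module Semantics (M : List For) (ws : List World)
    (consistent : ∀ {w} → w ∈ ws → ¬ diagram w (atoms M) ⊢ ⊥̇)
    (complete : ∀ {w} → w ∈ worlds (atoms M) → w ∈ ws ⊎ diagram w (atoms M) ⊢ ⊥̇) where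

    true-in : ∀ {w} → w ∈ ws → Over M α → [] ⊢ α → eval w α ≡ true
    true-in {α} {w} p o d with eval w α | diagram-decides w o
    ... | true  | _ = refl
    ... | false | e = contradiction (mp e (weaken (λ ()) d)) (consistent p)

    false-in : ∀ {w} → w ∈ ws → Over M ⊥̇ → eval w ⊥̇ ≡ false
    false-in {w} p o with eval w ⊥̇ | diagram-decides w o
    ... | true  | d = contradiction d (consistent p)
    ... | false | _ = refl

    ↔-sound : Over M α → Over M β → [] ⊢ α ↔̇ β → ∀ {w} → w ∈ ws → eval w α ≡ eval w β
    ↔-sound {α} {β} o o′ d {w} p =
      eval-↔ w α β (true-in p ((o →̇ o′) ∧̇ (o′ →̇ o)) d)

    -- Every diagram proves the biconditional: for a world in `ws` because both sides evaluate alike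
    -- there, for any other by explosion.
    ↔-complete : Over M α → Over M β → (∀ {w} → w ∈ ws → eval w α ≡ eval w β) → [] ⊢ α ↔̇ β
    ↔-complete {α} {β} o o′ h = worlds-exhaustive (atoms M) λ {w} p → at w (complete p)
      where
      at : ∀ w → w ∈ ws ⊎ diagram w (atoms M) ⊢ ⊥̇ → diagram w (atoms M) ⊢ α ↔̇ β
      at w (inj₁ p) = subst (λ b → diagram w (atoms M) ⊢ lit b (α ↔̇ β)) (↔-eval w α β (h p))
        (diagram-decides w ((o →̇ o′) ∧̇ (o′ →̇ o)))
      at w (inj₂ d) = explode d

-- Irrefutability of finite partitions.

module _ {A : Set} where

  sublists : List A → List (List A)
  sublists []       = [] ∷ []
  sublists (x ∷ xs) = map (x ∷_) (sublists xs) ++ sublists xs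

  -- Excluded middle for `P` is irrefutable at one element, hence at finitely many in succession.
  ¬¬-partition : (P : A → Set) (xs : List A) →
    ¬ ¬ ∃ λ ys → ys ∈ sublists xs × (∀ {x} → x ∈ ys → ¬ P x) × (∀ {x} → x ∈ xs → x ∈ ys ⊎ P x)
  ¬¬-partition P []       k = k ([] , here refl , (λ ()) , λ ())
  ¬¬-partition P (x ∷ xs) k = ¬¬-partition P xs λ (ys , ys∈ , f , g) →
    -- The list keeping `x` is offered first; should a proof of `P x` refute that choice, it
    -- justifies offering the list without `x`.
    k (x ∷ ys , ∈-++⁺ˡ (∈-map⁺ (x ∷_) ys∈)
      , (λ { (here refl) p → k (ys , ∈-++⁺ʳ (map (x ∷_) (sublists xs)) ys∈ , f
             , λ { (here refl) → inj₂ p ; (there q) → g q })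
           ; (there q) → f q })
      , λ { (here refl) → inj₁ (here refl)
          ; (there q) → [_,_]′ (inj₁ ∘ there) inj₂ (g q) })

-- Conditional equations on the values of formulas.

infix 3 _≐_⟹_≐_

data Rule : Set where
  _≐_⟹_≐_ : For → For → For → For → Rule

-- Over pairs α, γ from M these are all the constraints that a finite algebra
-- has to satisfy at the values of M for ¬ and ∘ to extend to a BALFI in BI(Ax).
-- A premise α ≐ α stands for no premise.
specificRules : Schema → For → For → List Rule
specificRules ciw α γ
  = (α ≐ α ⟹ ∘̇ α ∨̇ (α ∧̇ ¬̇ α) ≐ ⊤̇)
  ∷ []
-- For `ci` and `cl` the first rule serves when the value to be negated, `⟦∘α⟧` or `⟦α ∧ ¬α⟧`, is
-- not a value of `M`: negation is complement there, and the schema reduces to ciw.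
specificRules ci α γ
  = (α ≐ α ⟹ ∘̇ α ∨̇ (α ∧̇ ¬̇ α) ≐ ⊤̇)
  ∷ (γ ≐ ∘̇ α ⟹ ¬̇ γ →̇ (α ∧̇ ¬̇ α) ≐ ⊤̇)
  ∷ (γ ≐ ⊤̇ ⟹ ¬̇ γ ≐ ⊥̇)
  ∷ []
specificRules cl α γ
  = (α ≐ α ⟹ ∘̇ α ∨̇ (α ∧̇ ¬̇ α) ≐ ⊤̇)
  ∷ (γ ≐ α ∧̇ ¬̇ α ⟹ ¬̇ γ →̇ ∘̇ α ≐ ⊤̇)
  ∷ []
specificRules cf α γ
  = (γ ≐ ⊤̇ ⟹ ¬̇ γ ≐ ⊥̇)
  -- These two rules give `lift` excluded middle and make it depend only on `⟦¬α⟧`.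
  ∷ (α ≐ α ⟹ ¬̇ α ∨̇ ¬̇ ¬̇ α ≐ ⊤̇)
  ∷ (¬̇ γ ≐ ¬̇ α ⟹ ¬̇ ¬̇ γ ≐ ¬̇ ¬̇ α)
  ∷ (γ ≐ ¬̇ α ⟹ ¬̇ γ →̇ α ≐ ⊤̇)
  ∷ (α ≐ α ⟹ ¬̇ ¬̇ α →̇ α ≐ ⊤̇)
  -- A lifted value may coincide with the value of `γ` or of `¬γ`; the last two rules serve `N-lift`
  -- in that event.
  ∷ (γ ≐ ¬̇ ¬̇ α ⟹ ¬̇ γ →̇ ¬̇ α ≐ ⊤̇)
  ∷ (¬̇ γ ≐ ¬̇ ¬̇ α ⟹ ¬̇ ¬̇ γ →̇ ¬̇ α ≐ ⊤̇)
  ∷ []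
specificRules d1 α γ
  = (α ≐ α ⟹ ∘̇ α ∨̇ α ≐ ⊤̇)
  ∷ []
specificRules d2 α γ
  = (α ≐ α ⟹ ∘̇ α ∨̇ ¬̇ α ≐ ⊤̇)
  ∷ []
specificRules a∘ α γ
  = (γ ≐ ∘̇ α ⟹ ∘̇ γ ≐ ⊤̇)
  ∷ (γ ≐ ⊤̇ ⟹ ∘̇ γ ≐ ⊤̇)
  ∷ []

rules : Schema → For → For → List Rule
rules Ax α γ
  = (α ≐ α ⟹ α ∨̇ ¬̇ α ≐ ⊤̇)
  ∷ (α ≐ α ⟹ (α ∧̇ ¬̇ α) ∧̇ ∘̇ α ≐ ⊥̇)
  ∷ (γ ≐ α ⟹ ¬̇ γ ≐ ¬̇ α)
  ∷ (γ ≐ α ⟹ ∘̇ γ ≐ ∘̇ α)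
  ∷ specificRules Ax α γ

-- Admissibility of the rules in the calculus.

module Soundness (Ax : Schema) where
  open Calculus Ax

  private variable
    Δ : List For
    α β : For

  Admissible : Rule → Set
  Admissible (α ≐ β ⟹ χ ≐ ψ) = [] ⊢ α ↔̇ β → [] ⊢ χ ↔̇ ψ

  weaken₀ : [] ⊢ α → Δ ⊢ α
  weaken₀ = weaken λ ()

  cong¬ : [] ⊢ α ↔̇ β → Δ ⊢ ¬̇ α ↔̇ ¬̇ β
  cong¬ d = thm (R¬ (theorem d))

  cong∘ : [] ⊢ α ↔̇ β → Δ ⊢ ∘̇ α ↔̇ ∘̇ β
  cong∘ d = thm (R∘ (theorem d))

  axiom : ∀ α → Δ ⊢ instantiate Ax α
  axiom α = thm (extra α)

  valid : [] ⊢ α → [] ⊢ α ↔̇ ⊤̇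
  valid d = iff (lam #0) (weaken₀ d)

  absurd : α ∷ [] ⊢ ⊥̇ → [] ⊢ α ↔̇ ⊥̇
  absurd d = iff d (explode #0)

  valid⁻ : [] ⊢ α ↔̇ ⊤̇ → [] ⊢ α
  valid⁻ d = from d (lam #0)

  ⊤̇-proof : Δ ⊢ ⊤̇
  ⊤̇-proof = lam #0

  valid-↔ : [] ⊢ α ↔̇ ⊤̇ → [] ⊢ β → [] ⊢ α ↔̇ β
  valid-↔ d e = iff (weaken₀ e) (from (weaken₀ d) ⊤̇-proof)

open Soundness using (Admissible)

-- A premise `γ ≐ ⊤̇` is used by trading `⊤̇` for a theorem suited to the schema: `∘⊥̇` for ci,
-- `¬⊥̇` for cf, `∘∘α` for a∘. Replacement under `R¬` or `R∘` then leads to an instance of the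
-- schema.
specificRules-admissible : ∀ Ax α γ → All (Admissible Ax) (specificRules Ax α γ)
specificRules-admissible ciw α γ = (λ _ → valid (axiom α)) ∷ []
  where open Calculus ciw; open Soundness ciw
specificRules-admissible ci α γ
  = (λ _ → valid (ciw-theorem α))
  ∷ (λ d → valid (lam (mp (axiom α) (to (cong¬ d) #0))))
  ∷ (λ d → absurd (fst (mp (axiom ⊥̇) (to (cong¬ (valid-↔ d ∘⊥̇)) #0))))
  ∷ []
  where
  open Calculus ci
  open Soundness ci

  ciw-theorem : ∀ α → [] ⊢ ∘̇ α ∨̇ (α ∧̇ ¬̇ α)
  ciw-theorem α = cases (thm (em (∘̇ α))) (inl #0) (inr (mp (axiom α) #0))

  ∘⊥̇ : [] ⊢ ∘̇ ⊥̇
  ∘⊥̇ = cases (ciw-theorem ⊥̇) #0 (explode (fst #0))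
specificRules-admissible cl α γ
  = (λ _ → valid (cases (thm (em (α ∧̇ ¬̇ α))) (inr #0) (inl (mp (axiom α) #0))))
  ∷ (λ d → valid (lam (mp (axiom α) (to (cong¬ d) #0))))
  ∷ []
  where open Calculus cl; open Soundness cl
specificRules-admissible cf α γ
  = (λ d → absurd (mp (axiom ⊥̇) (to (cong¬ (valid-↔ d ¬⊥̇)) #0)))
  ∷ (λ _ → valid (thm (em (¬̇ α))))
  ∷ (λ d → cong¬ d)
  ∷ (λ d → valid (lam (mp (axiom α) (to (cong¬ d) #0))))
  ∷ (λ _ → valid (axiom α))
  ∷ (λ d → valid (lam (mp (axiom (¬̇ α)) (to (cong¬ d) #0))))
  ∷ (λ d → valid (lam (mp (axiom (¬̇ α)) (to (cong¬ d) #0))))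
  ∷ []
  where
  open Calculus cf
  open Soundness cf

  ¬⊥̇ : [] ⊢ ¬̇ ⊥̇
  ¬⊥̇ = cases (thm (em ⊥̇)) (explode #0) #0
specificRules-admissible d1 α γ = (λ _ → valid (axiom α)) ∷ []
  where open Calculus d1; open Soundness d1
specificRules-admissible d2 α γ = (λ _ → valid (axiom α)) ∷ []
  where open Calculus d2; open Soundness d2
specificRules-admissible a∘ α γ
  = (λ d → valid (from (cong∘ d) (axiom α)))
  ∷ (λ d → valid (from (cong∘ (valid-↔ d (axiom α))) (axiom (∘̇ α))))
  ∷ []
  where open Calculus a∘; open Soundness a∘

rules-admissible : ∀ Ax α γ → All (Admissible Ax) (rules Ax α γ)
rules-admissible Ax α γ
  = (λ _ → valid (thm (em α)))
  ∷ (λ _ → absurd (gentle-explosion #0))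
  ∷ (λ d → cong¬ d)
  ∷ (λ d → cong∘ d)
  ∷ specificRules-admissible Ax α γ
  where open Calculus Ax; open Soundness Ax

-- The rules speak only of Boolean combinations of atoms.

RuleOver : List For → Rule → Set
RuleOver M (α ≐ β ⟹ χ ≐ ψ) = Over M α × Over M β × Over M χ × Over M ψ

module _ {M : List For} (M-over : All (Over M) M) (⊥-over : Over M ⊥̇)
  {α γ : For} (α∈ : α ∈ M) (γ∈ : γ ∈ M) where

  private
    α° : Over M α
    α° = All.lookup M-over α∈

    γ° : Over M γ
    γ° = All.lookup M-over γ∈

    ⊤° : Over M ⊤̇
    ⊤° = ⊥-over →̇ ⊥-over

    ¬° : ∀ {β} → β ∈ M → Over M (¬̇ β)
    ¬° p = ¬̇ ∈-++⁺ˡ p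

    ∘° : ∀ {β} → β ∈ M → Over M (∘̇ β)
    ∘° p = ∘̇ ∈-++⁺ˡ p

    ¬¬° : ∀ {β} → β ∈ M → Over M (¬̇ ¬̇ β)
    ¬¬° p = ¬̇ ∈-++⁺ʳ M (∈-map⁺ ¬̇_ p)

  specificRules-over : ∀ Ax → All (RuleOver M) (specificRules Ax α γ)
  specificRules-over ciw
    = (α° , α° , (∘° α∈ ∨̇ (α° ∧̇ ¬° α∈)) , ⊤°)
    ∷ []
  specificRules-over ci
    = (α° , α° , (∘° α∈ ∨̇ (α° ∧̇ ¬° α∈)) , ⊤°)
    ∷ (γ° , ∘° α∈ , (¬° γ∈ →̇ (α° ∧̇ ¬° α∈)) , ⊤°)
    ∷ (γ° , ⊤° , ¬° γ∈ , ⊥-over)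
    ∷ []
  specificRules-over cl
    = (α° , α° , (∘° α∈ ∨̇ (α° ∧̇ ¬° α∈)) , ⊤°)
    ∷ (γ° , (α° ∧̇ ¬° α∈) , (¬° γ∈ →̇ ∘° α∈) , ⊤°)
    ∷ []
  specificRules-over cf
    = (γ° , ⊤° , ¬° γ∈ , ⊥-over)
    ∷ (α° , α° , (¬° α∈ ∨̇ ¬¬° α∈) , ⊤°)
    ∷ (¬° γ∈ , ¬° α∈ , ¬¬° γ∈ , ¬¬° α∈)
    ∷ (γ° , ¬° α∈ , (¬° γ∈ →̇ α°) , ⊤°)
    ∷ (α° , α° , (¬¬° α∈ →̇ α°) , ⊤°)
    ∷ (γ° , ¬¬° α∈ , (¬° γ∈ →̇ ¬° α∈) , ⊤°)
    ∷ (¬° γ∈ , ¬¬° α∈ , (¬¬° γ∈ →̇ ¬° α∈) , ⊤°)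
    ∷ []
  specificRules-over d1 = (α° , α° , (∘° α∈ ∨̇ α°) , ⊤°) ∷ []
  specificRules-over d2 = (α° , α° , (∘° α∈ ∨̇ ¬° α∈) , ⊤°) ∷ []
  specificRules-over a∘
    = (γ° , ∘° α∈ , ∘° γ∈ , ⊤°)
    ∷ (γ° , ⊤° , ∘° γ∈ , ⊤°)
    ∷ []

  rules-over : ∀ Ax → All (RuleOver M) (rules Ax α γ)
  rules-over Ax
    = (α° , α° , (α° ∨̇ ¬° α∈) , ⊤°)
    ∷ (α° , α° , ((α° ∧̇ ¬° α∈) ∧̇ ∘° α∈) , ⊥-over)
    ∷ (γ° , α° , ¬° γ∈ , ¬° α∈)
    ∷ (γ° , α° , ∘° γ∈ , ∘° α∈)
    ∷ specificRules-over Ax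

-- Finite Boolean algebras interpreting formulas.

-- Only the Boolean connectives are respected. The values `⟦¬α⟧` and `⟦∘α⟧` are raw data for partial
-- operations, and decidable equality makes the search for a suitable algebra possible.
record Interpretation : Set₁ where
  infix  9 ∼_
  infixr 8 _⋏_
  infixr 7 _⋎_
  infix  4 _≟_
  field
    Carrier   : Set
    _⋎_ _⋏_   : Op₂ Carrier
    ∼_        : Op₁ Carrier
    𝟏 𝟎       : Carrier
    isBooleanAlgebra : IsBooleanAlgebra _≡_ _⋎_ _⋏_ ∼_ 𝟏 𝟎
    _≟_       : DecidableEquality Carrier
    size      : ℕ
    finite    : Carrier ↔ Fin size
    ⟦_⟧       : For → Carrier
    ⟦∧⟧       : ∀ α β → ⟦ α ∧̇ β ⟧ ≡ ⟦ α ⟧ ⋏ ⟦ β ⟧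
    ⟦∨⟧       : ∀ α β → ⟦ α ∨̇ β ⟧ ≡ ⟦ α ⟧ ⋎ ⟦ β ⟧
    ⟦→⟧       : ∀ α β → ⟦ α →̇ β ⟧ ≡ ∼ ⟦ α ⟧ ⋎ ⟦ β ⟧

  booleanAlgebra : BooleanAlgebra 0ℓ 0ℓ
  booleanAlgebra = record { isBooleanAlgebra = isBooleanAlgebra }

  Satisfies : Rule → Set
  Satisfies (α ≐ β ⟹ χ ≐ ψ) = ⟦ α ⟧ ≡ ⟦ β ⟧ → ⟦ χ ⟧ ≡ ⟦ ψ ⟧

  satisfies? : ∀ r → Dec (Satisfies r)
  satisfies? (α ≐ β ⟹ χ ≐ ψ) = (⟦ α ⟧ ≟ ⟦ β ⟧) →-dec (⟦ χ ⟧ ≟ ⟦ ψ ⟧)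

  SatisfiesRules : Schema → List For → Set
  SatisfiesRules Ax M = All (λ α → All (λ γ → All Satisfies (rules Ax α γ)) M) M

  Countermodel : Schema → List For → For → Set
  Countermodel Ax M φ = ⟦ ⊥̇ ⟧ ≡ 𝟎 × SatisfiesRules Ax M × ⟦ φ ⟧ ≢ ⟦ ⊤̇ ⟧

  countermodel? : ∀ Ax M φ → Dec (Countermodel Ax M φ)
  countermodel? Ax M φ = (⟦ ⊥̇ ⟧ ≟ 𝟎)
    ×-dec All.all? (λ α → All.all? (λ γ → All.all? satisfies? (rules Ax α γ)) M) M
    ×-dec ¬? (⟦ φ ⟧ ≟ ⟦ ⊤̇ ⟧)

subset↔Fin : ∀ n → Subset n ↔ Fin (2 ^ n)
subset↔Fin zero    = ↔-trans (mk↔ₛ′ (λ _ → tt) (λ _ → []) (λ _ → refl) (λ { [] → refl })) (↔-sym 1↔⊤)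
subset↔Fin (suc n) = ↔-trans uncons (↔-trans (↔-sym 2↔Bool ×-↔ subset↔Fin n) (↔-sym *↔×))
  where
  uncons : Subset (suc n) ↔ (Bool × Subset n)
  uncons = mk↔ₛ′ (λ { (b ∷ s) → b , s }) (λ (b , s) → b ∷ s) (λ _ → refl) (λ { (_ ∷ _) → refl })

extension : (ws : List World) → For → Subset (length ws)
extension ws α = Vec.map (λ w → eval w α) (Vec.fromList ws)

worldsInterpretation : List World → Interpretation
worldsInterpretation ws = record
  { isBooleanAlgebra = ∪-∩-isBooleanAlgebra (length ws)
  ; _≟_              = Vec.≡-dec Bool._≟_
  ; finite           = subset↔Fin (length ws)
  ; ⟦_⟧              = extension ws
  ; ⟦∧⟧              = λ α β → binary ws
  ; ⟦∨⟧              = λ α β → binary ws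
  ; ⟦→⟧              = λ α β → implication ws α β
  }
  where
  binary : ∀ {f g : World → Bool} {_•_ : Op₂ Bool} ws →
    Vec.map (λ w → f w • g w) (Vec.fromList ws) ≡
    Vec.zipWith _•_ (Vec.map f (Vec.fromList ws)) (Vec.map g (Vec.fromList ws))
  binary []       = refl
  binary (w ∷ ws) = cong (_ ∷_) (binary ws)

  implication : ∀ ws α β → extension ws (α →̇ β) ≡ ∁ (extension ws α) ∪ extension ws β
  implication []       α β = refl
  implication (w ∷ ws) α β = cong (_ ∷_) (implication ws α β)

extension-cong : ∀ ws α β → (∀ {w} → w ∈ ws → eval w α ≡ eval w β) →
  extension ws α ≡ extension ws β
extension-cong []       α β h = refl
extension-cong (w ∷ ws) α β h = cong₂ _∷_ (h (here refl)) (extension-cong ws α β (h ∘ there))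

extension-injective : ∀ ws α β → extension ws α ≡ extension ws β →
  ∀ {w} → w ∈ ws → eval w α ≡ eval w β
extension-injective (w ∷ ws) α β p (here refl) = Vec.∷-injectiveˡ p
extension-injective (w ∷ ws) α β p (there w∈)  =
  extension-injective ws α β (Vec.∷-injectiveʳ p) w∈

extension-⊥ : ∀ ws α → (∀ {w} → w ∈ ws → eval w α ≡ false) → extension ws α ≡ ⊥
extension-⊥ []       α h = refl
extension-⊥ (w ∷ ws) α h = cong₂ _∷_ (h (here refl)) (extension-⊥ ws α (h ∘ there))

-- Existence of a suitable set of worlds.

module _ (Ax : Schema) {M : List For} {φ : For} (M-over : All (Over M) M)
  (⊥-over : Over M ⊥̇) (φ-over : Over M φ) (⊬φ : ¬ RmbC[ Ax ]⊢ φ) where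

  open Calculus Ax
  open Soundness Ax using (valid⁻)

  private
    IsCountermodel : List World → Set
    IsCountermodel ws = Interpretation.Countermodel (worldsInterpretation ws) Ax M φ

    -- Over the consistent worlds, extensions of Boolean combinations are equal exactly when the
    -- formulas are provably equivalent. Admissible rules thus become satisfied ones, and the
    -- unprovable `φ` differs from `⊤̇`.
    countermodel : (ws : List World) →
      (∀ {w} → w ∈ ws → ¬ diagram w (atoms M) ⊢ ⊥̇) →
      (∀ {w} → w ∈ worlds (atoms M) → w ∈ ws ⊎ diagram w (atoms M) ⊢ ⊥̇) →
      IsCountermodel ws
    countermodel ws consistent complete =
      extension-⊥ ws ⊥̇ (λ p → false-in p ⊥-over) ,
      All.tabulate (λ {α} α∈ → All.tabulate λ {γ} γ∈ →
        All.zipWith (λ {r} → satisfied {r})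
          (rules-over M-over ⊥-over α∈ γ∈ Ax , rules-admissible Ax α γ)) ,
      λ p → ⊬φ (theorem (valid⁻ (↔-complete φ-over (⊥-over →̇ ⊥-over) (extension-injective ws φ ⊤̇ p))))
      where
      open Semantics M ws consistent complete
      open Interpretation (worldsInterpretation ws) using (Satisfies)

      satisfied : ∀ {r} → RuleOver M r × Admissible Ax r → Satisfies r
      satisfied {α ≐ β ⟹ χ ≐ ψ} ((oα , oβ , oχ , oψ) , d) p =
        extension-cong ws χ ψ
          (↔-sound oχ oψ (d (↔-complete oα oβ (extension-injective ws α β p))))

  -- The partition into consistent and inconsistent worlds exists only under a
  -- double negation, which refutes the failure of the decidable search.
  countermodel-exists : ∃ IsCountermodel
  countermodel-exists with
    any? (λ ws → Interpretation.countermodel? (worldsInterpretation ws) Ax M φ)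
         (sublists (worlds (atoms M)))
  ... | yes p = map₂ proj₂ (find p)
  ... | no ¬p = contradiction
    (λ (ws , ws∈ , consistent , complete) → ¬p (lose ws∈ (countermodel ws consistent complete)))
    (¬¬-partition _ (worlds (atoms M)))

-- The square of an interpretation, with formulas on the diagonal.

double : Interpretation → Interpretation
double I = record
  { _⋎_              = λ (x , y) (x′ , y′) → x ⋎ x′ , y ⋎ y′
  ; _⋏_              = λ (x , y) (x′ , y′) → x ⋏ x′ , y ⋏ y′
  ; ∼_               = λ (x , y) → ∼ x , ∼ y
  ; 𝟏                = 𝟏 , 𝟏
  ; 𝟎                = 𝟎 , 𝟎
  ; isBooleanAlgebra = isBooleanAlgebraʳ record
    { isDistributiveLattice = isDistributiveLatticeʳʲᵐ record
      { isLattice = record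
        { isEquivalence = isEquivalence
        ; ∨-comm        = λ _ _ → cong₂ _,_ (∨-comm _ _) (∨-comm _ _)
        ; ∨-assoc       = λ _ _ _ → cong₂ _,_ (∨-assoc _ _ _) (∨-assoc _ _ _)
        ; ∨-cong        = cong₂ _
        ; ∧-comm        = λ _ _ → cong₂ _,_ (∧-comm _ _) (∧-comm _ _)
        ; ∧-assoc       = λ _ _ _ → cong₂ _,_ (∧-assoc _ _ _) (∧-assoc _ _ _)
        ; ∧-cong        = cong₂ _
        ; absorptive    = (λ _ _ → cong₂ _,_ (∨-absorbs-∧ _ _) (∨-absorbs-∧ _ _))
                        , (λ _ _ → cong₂ _,_ (∧-absorbs-∨ _ _) (∧-absorbs-∨ _ _))
        }
      ; ∨-distribʳ-∧ = λ _ _ _ → cong₂ _,_ (∨-distribʳ-∧ _ _ _) (∨-distribʳ-∧ _ _ _)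
      }
    ; ∨-complementʳ = λ _ → cong₂ _,_ (∨-complementʳ _) (∨-complementʳ _)
    ; ∧-complementʳ = λ _ → cong₂ _,_ (∧-complementʳ _) (∧-complementʳ _)
    ; ¬-cong        = λ { refl → refl }
    }
  ; _≟_              = ≡-dec _≟_ _≟_
  ; finite           = ↔-trans (finite ×-↔ finite) (↔-sym *↔×)
  ; ⟦_⟧              = λ α → ⟦ α ⟧ , ⟦ α ⟧
  ; ⟦∧⟧              = λ α β → cong₂ _,_ (⟦∧⟧ α β) (⟦∧⟧ α β)
  ; ⟦∨⟧              = λ α β → cong₂ _,_ (⟦∨⟧ α β) (⟦∨⟧ α β)
  ; ⟦→⟧              = λ α β → cong₂ _,_ (⟦→⟧ α β) (⟦→⟧ α β)
  }
  where
  open Interpretation I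
  open IsBooleanAlgebra isBooleanAlgebra hiding (isEquivalence; refl)

-- Total extensions of finite partial maps.

module Extend {A X : Set} (_≟_ : DecidableEquality A) where

  extend : (key val : X → A) → List X → (A → A) → A → A
  extend key val xs default a with any? (λ x → key x ≟ a) xs
  ... | yes p = val (proj₁ (find p))
  ... | no _  = default a

  module _ {key val : X → A} {xs : List X} {default : A → A} where

    -- The search may stop at another element with the same key, so functionality at this key is
    -- required.
    extend-∈ : ∀ {x} → x ∈ xs → (∀ {y} → y ∈ xs → key y ≡ key x → val y ≡ val x) →
      extend key val xs default (key x) ≡ val x
    extend-∈ {x} x∈ respects with any? (λ y → key y ≟ key x) xs
    ... | yes p with _ , y∈ , eq ← find p = respects y∈ eq
    ... | no ¬p = contradiction (lose x∈ refl) ¬p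

    extend-∉ : ∀ {a} → (∀ {x} → x ∈ xs → key x ≢ a) → extend key val xs default a ≡ default a
    extend-∉ {a} a∉ with any? (λ x → key x ≟ a) xs
    ... | yes p with _ , x∈ , eq ← find p = contradiction eq (a∉ x∈)
    ... | no _  = refl

  locate : ∀ (key : X → A) xs a → (∃ λ x → x ∈ xs × key x ≡ a) ⊎ (∀ {x} → x ∈ xs → key x ≢ a)
  locate key xs a with any? (λ x → key x ≟ a) xs
  ... | yes p = inj₁ (find p)
  ... | no ¬p = inj₂ λ x∈ eq → ¬p (lose x∈ eq)

-- Completions and the BALFIs they determine.

module _ (I : Interpretation) where
  open Interpretation I

  schemaValue : (N C : Op₁ Carrier) → Schema → Carrier → Carrier
  schemaValue N C ciw a = C a ⋎ (a ⋏ N a)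
  schemaValue N C ci  a = ∼ N (C a) ⋎ (a ⋏ N a)
  schemaValue N C cl  a = ∼ N (a ⋏ N a) ⋎ C a
  schemaValue N C cf  a = ∼ N (N a) ⋎ a
  schemaValue N C d1  a = C a ⋎ a
  schemaValue N C d2  a = C a ⋎ N a
  schemaValue N C a∘  a = C (C a)

  record Completion (Ax : Schema) (M : List For) : Set where
    field
      N C      : Op₁ Carrier
      N-em     : ∀ a → a ⋎ N a ≡ 𝟏
      C-law    : ∀ a → (a ⋏ N a) ⋏ C a ≡ 𝟎
      schema   : ∀ a → schemaValue N C Ax a ≡ 𝟏
      N-agrees : ∀ {α} → α ∈ M → N ⟦ α ⟧ ≡ ⟦ ¬̇ α ⟧
      C-agrees : ∀ {α} → α ∈ M → C ⟦ α ⟧ ≡ ⟦ ∘̇ α ⟧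

Refutation : Schema → For → Set₁
Refutation Ax φ = Σ (BALFI 0ℓ 0ℓ) λ A → Finite A × BI Ax A ×
  Σ (Valuation A) λ v → ¬ (BALFI._≈_ A (value v φ) (BALFI.⊤ A))

module CompletedModel {I : Interpretation} {Ax : Schema} {M : List For}
  (completion : Completion I Ax M) where

  open Interpretation I
  open Completion completion

  balfi : BALFI 0ℓ 0ℓ
  balfi = record
    { booleanAlgebra = booleanAlgebra
    ; _⇒_    = λ a b → ∼ a ⋎ b
    ; ¬_     = N
    ; ○_     = C
    ; ¬-cong = cong N
    ; ○-cong = cong C
    ; ⇒-def  = λ _ _ → refl
    ; ¬-em   = N-em
    ; ○-law  = C-law
    }

  balfi∈BI : BI Ax balfi
  balfi∈BI v α = trans (value-instantiate Ax) (schema (value v α))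
    where
    open Valuation v using (∧-homo; ∨-homo; →-homo; ¬-homo; ∘-homo)

    value-contradiction : value v (α ∧̇ ¬̇ α) ≡ value v α ⋏ N (value v α)
    value-contradiction = trans (∧-homo _ _) (cong (_ ⋏_) (¬-homo _))

    value-instantiate : ∀ Ax → value v (instantiate Ax α) ≡ schemaValue I N C Ax (value v α)
    value-instantiate ciw = trans (∨-homo _ _) (cong₂ _⋎_ (∘-homo _) value-contradiction)
    value-instantiate ci  = trans (→-homo _ _)
      (cong₂ (λ a b → ∼ a ⋎ b) (trans (¬-homo _) (cong N (∘-homo _))) value-contradiction)
    value-instantiate cl  = trans (→-homo _ _)
      (cong₂ (λ a b → ∼ a ⋎ b) (trans (¬-homo _) (cong N value-contradiction)) (∘-homo _))
    value-instantiate cf  = trans (→-homo _ _)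
      (cong (λ a → ∼ a ⋎ _) (trans (¬-homo _) (cong N (¬-homo _))))
    value-instantiate d1  = trans (∨-homo _ _) (cong (_⋎ _) (∘-homo _))
    value-instantiate d2  = trans (∨-homo _ _) (cong₂ _⋎_ (∘-homo _) (¬-homo _))
    value-instantiate a∘  = trans (∘-homo _) (cong C (∘-homo _))

  evaluate : For → Carrier
  evaluate (var n)  = ⟦ var n ⟧
  evaluate (α ∧̇ β) = evaluate α ⋏ evaluate β
  evaluate (α ∨̇ β) = evaluate α ⋎ evaluate β
  evaluate (α →̇ β) = ∼ evaluate α ⋎ evaluate β
  evaluate (¬̇ α)   = N (evaluate α)
  evaluate (∘̇ α)   = C (evaluate α)

  valuation : Valuation balfi
  valuation = record
    { value  = evaluate
    ; ∧-homo = λ _ _ → refl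
    ; ∨-homo = λ _ _ → refl
    ; →-homo = λ _ _ → refl
    ; ¬-homo = λ _ → refl
    ; ∘-homo = λ _ → refl
    }

  -- The truth lemma: at `¬̇` and `∘̇` the immediate subformula lies in `M`, where `N` and `C` are
  -- prescribed.
  evaluate-agrees : ∀ α → sub α ⊆ M → evaluate α ≡ ⟦ α ⟧
  evaluate-agrees (var n)  s = refl
  evaluate-agrees (α ∧̇ β) s with sα , sβ ← sub-binary {γ = α ∧̇ β} α β s =
    trans (cong₂ _⋏_ (evaluate-agrees α sα) (evaluate-agrees β sβ)) (sym (⟦∧⟧ α β))
  evaluate-agrees (α ∨̇ β) s with sα , sβ ← sub-binary {γ = α ∨̇ β} α β s =
    trans (cong₂ _⋎_ (evaluate-agrees α sα) (evaluate-agrees β sβ)) (sym (⟦∨⟧ α β))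
  evaluate-agrees (α →̇ β) s with sα , sβ ← sub-binary {γ = α →̇ β} α β s =
    trans (cong₂ (λ a b → ∼ a ⋎ b) (evaluate-agrees α sα) (evaluate-agrees β sβ)) (sym (⟦→⟧ α β))
  evaluate-agrees (¬̇ α)   s = trans (cong N (evaluate-agrees α (s ∘ there)))
    (N-agrees (s (there (self∈sub α))))
  evaluate-agrees (∘̇ α)   s = trans (cong C (evaluate-agrees α (s ∘ there)))
    (C-agrees (s (there (self∈sub α))))

  refutation : ∀ {φ} → sub φ ⊆ M → ⟦ φ ⟧ ≢ 𝟏 → Refutation Ax φ
  refutation {φ} s ≢𝟏 = balfi , (size , record { Inverse finite }) , balfi∈BI , valuation ,
    λ p → ≢𝟏 (trans (sym (evaluate-agrees φ s)) p)

-- Consequences of the rules in the algebra.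

module Rules {I : Interpretation} {Ax : Schema} {M : List For}
  (⟦⊥⟧ : Interpretation.⟦_⟧ I ⊥̇ ≡ Interpretation.𝟎 I)
  (sat : Interpretation.SatisfiesRules I Ax M) where

  open Interpretation I public
  open BooleanAlgebraProperties booleanAlgebra public
  open IsBooleanAlgebra isBooleanAlgebra public
    using (∨-comm; ∨-complementʳ; ∨-complementˡ; ∧-complementʳ)

  private variable
    α β γ χ : For

  rulesFor : α ∈ M → γ ∈ M → All Satisfies (rules Ax α γ)
  rulesFor α∈ γ∈ = All.lookup (All.lookup sat α∈) γ∈

  ⟦⊤⟧ : ⟦ ⊤̇ ⟧ ≡ 𝟏
  ⟦⊤⟧ = trans (⟦→⟧ ⊥̇ ⊥̇) (∨-complementˡ ⟦ ⊥̇ ⟧)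

  implies : ⟦ α →̇ β ⟧ ≡ ⟦ ⊤̇ ⟧ → ∼ ⟦ α ⟧ ⋎ ⟦ β ⟧ ≡ 𝟏
  implies p = trans (sym (⟦→⟧ _ _)) (trans p ⟦⊤⟧)

  covers : ⟦ α ∨̇ β ⟧ ≡ ⟦ ⊤̇ ⟧ → ⟦ α ⟧ ⋎ ⟦ β ⟧ ≡ 𝟏
  covers p = trans (sym (⟦∨⟧ _ _)) (trans p ⟦⊤⟧)

  em-value : α ∈ M → ⟦ α ⟧ ⋎ ⟦ ¬̇ α ⟧ ≡ 𝟏
  em-value α∈ with r ∷ _ ← rulesFor α∈ α∈ = covers (r refl)

  bc-value : α ∈ M → (⟦ α ⟧ ⋏ ⟦ ¬̇ α ⟧) ⋏ ⟦ ∘̇ α ⟧ ≡ 𝟎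
  bc-value {α} α∈ with _ ∷ r ∷ _ ← rulesFor α∈ α∈ =
    trans (sym (trans (⟦∧⟧ _ _) (cong (_⋏ _) (⟦∧⟧ _ _)))) (trans (r refl) ⟦⊥⟧)

  ¬-respects : α ∈ M → γ ∈ M → ⟦ γ ⟧ ≡ ⟦ α ⟧ → ⟦ ¬̇ γ ⟧ ≡ ⟦ ¬̇ α ⟧
  ¬-respects α∈ γ∈ with _ ∷ _ ∷ r ∷ _ ← rulesFor α∈ γ∈ = r

  ∘-respects : α ∈ M → γ ∈ M → ⟦ γ ⟧ ≡ ⟦ α ⟧ → ⟦ ∘̇ γ ⟧ ≡ ⟦ ∘̇ α ⟧
  ∘-respects α∈ γ∈ with _ ∷ _ ∷ _ ∷ r ∷ _ ← rulesFor α∈ γ∈ = r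

  specific : α ∈ M → γ ∈ M → All Satisfies (specificRules Ax α γ)
  specific α∈ γ∈ with _ ∷ _ ∷ _ ∷ _ ∷ rs ← rulesFor α∈ γ∈ = rs

-- Completion by classical defaults, for every schema except cf.

module ClassicalDefault {I : Interpretation} {Ax : Schema} {M : List For}
  (⟦⊥⟧ : Interpretation.⟦_⟧ I ⊥̇ ≡ Interpretation.𝟎 I)
  (sat : Interpretation.SatisfiesRules I Ax M) where

  open Rules {I} {Ax} {M} ⟦⊥⟧ sat
  open Extend {X = For} _≟_

  N C : Op₁ Carrier
  N = extend ⟦_⟧ (⟦_⟧ ∘ ¬̇_) M ∼_
  C = extend ⟦_⟧ (⟦_⟧ ∘ ∘̇_) M (λ _ → 𝟏)

  private variable
    α : For
    a : Carrier

  N-agrees : α ∈ M → N ⟦ α ⟧ ≡ ⟦ ¬̇ α ⟧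
  N-agrees α∈ = extend-∈ α∈ (¬-respects α∈)

  C-agrees : α ∈ M → C ⟦ α ⟧ ≡ ⟦ ∘̇ α ⟧
  C-agrees α∈ = extend-∈ α∈ (∘-respects α∈)

  N-at : α ∈ M → ⟦ α ⟧ ≡ a → N a ≡ ⟦ ¬̇ α ⟧
  N-at α∈ refl = N-agrees α∈

  C-at : α ∈ M → ⟦ α ⟧ ≡ a → C a ≡ ⟦ ∘̇ α ⟧
  C-at α∈ refl = C-agrees α∈

  N-default : (∀ {α} → α ∈ M → ⟦ α ⟧ ≢ a) → N a ≡ ∼ a
  N-default = extend-∉

  C-default : (∀ {α} → α ∈ M → ⟦ α ⟧ ≢ a) → C a ≡ 𝟏
  C-default = extend-∉

  N-em : ∀ a → a ⋎ N a ≡ 𝟏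
  N-em a with locate ⟦_⟧ M a
  ... | inj₁ (α , α∈ , refl) rewrite N-agrees α∈ = em-value α∈
  ... | inj₂ a∉ rewrite N-default a∉ = ∨-complementʳ a

  C-law : ∀ a → (a ⋏ N a) ⋏ C a ≡ 𝟎
  C-law a with locate ⟦_⟧ M a
  ... | inj₁ (α , α∈ , refl) rewrite N-agrees α∈ | C-agrees α∈ = bc-value α∈
  ... | inj₂ a∉ rewrite N-default a∉ | ∧-complementʳ a = ∧-zeroˡ (C a)

  ⟦contradiction⟧ : ∀ α → ⟦ α ∧̇ ¬̇ α ⟧ ≡ ⟦ α ⟧ ⋏ ⟦ ¬̇ α ⟧
  ⟦contradiction⟧ α = ⟦∧⟧ α (¬̇ α)

  -- Case analysis on whether `a`, and then the argument of an outer `N` or `C`, is a value of `M`.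
  -- Quantifying over `Ax` anew lets a match on it compute the rules.
  schema : ∀ Ax → Ax ≢ cf →
    (∀ {α γ} → α ∈ M → γ ∈ M → All Satisfies (specificRules Ax α γ)) →
    ∀ a → schemaValue I N C Ax a ≡ 𝟏
  schema Ax ≢cf rule a with locate ⟦_⟧ M a
  schema ciw _ rule a | inj₁ (α , α∈ , refl) with r ∷ [] ← rule α∈ α∈
    rewrite N-agrees α∈ | C-agrees α∈ | sym (⟦contradiction⟧ α) = covers (r refl)
  schema ciw _ rule a | inj₂ a∉ rewrite C-default a∉ = ∨-zeroˡ _
  schema ci _ rule a | inj₁ (α , α∈ , refl)
    rewrite N-agrees α∈ | C-agrees α∈ | sym (⟦contradiction⟧ α) with locate ⟦_⟧ M ⟦ ∘̇ α ⟧
  ... | inj₁ (γ , γ∈ , p) with _ ∷ r ∷ _ ← rule α∈ γ∈ rewrite N-at γ∈ p =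
    implies (r p)
  ... | inj₂ b∉ with r ∷ _ ← rule α∈ α∈ rewrite N-default b∉ | ¬-involutive ⟦ ∘̇ α ⟧ =
    covers (r refl)
  -- Here `C a` is `𝟏`, so `N 𝟏` has to be `𝟎`: by a rule if `𝟏` is a value of `M`, by the default
  -- otherwise.
  schema ci _ rule a | inj₂ a∉ rewrite C-default a∉ with locate ⟦_⟧ M 𝟏
  ... | inj₁ (γ , γ∈ , p) with _ ∷ _ ∷ r ∷ [] ← rule γ∈ γ∈
    rewrite N-at γ∈ p | r (trans p (sym ⟦⊤⟧)) | ⟦⊥⟧ | ¬⊥≈⊤ = ∨-zeroˡ _
  ... | inj₂ 𝟏∉ rewrite N-default 𝟏∉ | ¬-involutive 𝟏 = ∨-zeroˡ _
  schema cl _ rule a | inj₁ (α , α∈ , refl)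
    rewrite N-agrees α∈ | C-agrees α∈ | sym (⟦contradiction⟧ α) with locate ⟦_⟧ M ⟦ α ∧̇ ¬̇ α ⟧
  ... | inj₁ (γ , γ∈ , p) with _ ∷ r ∷ [] ← rule α∈ γ∈ rewrite N-at γ∈ p =
    implies (r p)
  ... | inj₂ b∉ with r ∷ _ ← rule α∈ α∈ rewrite N-default b∉ | ¬-involutive ⟦ α ∧̇ ¬̇ α ⟧ =
    trans (∨-comm _ _) (covers (r refl))
  schema cl _ rule a | inj₂ a∉ rewrite C-default a∉ = ∨-zeroʳ _
  schema cf ≢cf rule a | _ = contradiction refl ≢cf
  schema d1 _ rule a | inj₁ (α , α∈ , refl) with r ∷ [] ← rule α∈ α∈
    rewrite C-agrees α∈ = covers (r refl)
  schema d1 _ rule a | inj₂ a∉ rewrite C-default a∉ = ∨-zeroˡ _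
  schema d2 _ rule a | inj₁ (α , α∈ , refl) with r ∷ [] ← rule α∈ α∈
    rewrite N-agrees α∈ | C-agrees α∈ = covers (r refl)
  schema d2 _ rule a | inj₂ a∉ rewrite C-default a∉ = ∨-zeroˡ _
  schema a∘ _ rule a | inj₁ (α , α∈ , refl) rewrite C-agrees α∈ with locate ⟦_⟧ M ⟦ ∘̇ α ⟧
  ... | inj₁ (γ , γ∈ , p) with r ∷ _ ← rule α∈ γ∈ rewrite C-at γ∈ p =
    trans (r p) ⟦⊤⟧
  ... | inj₂ b∉ = C-default b∉
  schema a∘ _ rule a | inj₂ a∉ rewrite C-default a∉ with locate ⟦_⟧ M 𝟏
  ... | inj₁ (γ , γ∈ , p) with _ ∷ r ∷ [] ← rule γ∈ γ∈ =
    trans (C-at γ∈ p) (trans (r (trans p (sym ⟦⊤⟧))) ⟦⊤⟧)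
  ... | inj₂ 𝟏∉ = C-default 𝟏∉

  completion : Ax ≢ cf → Completion I Ax M
  completion ≢cf = record
    { N = N ; C = C ; N-em = N-em ; C-law = C-law ; schema = schema Ax ≢cf specific
    ; N-agrees = N-agrees ; C-agrees = C-agrees }

-- Completion on the square, for cf.

module Doubled {I : Interpretation} {M : List For} (⊤∈M : ⊤̇ ∈ M)
  (⟦⊥⟧ : Interpretation.⟦_⟧ I ⊥̇ ≡ Interpretation.𝟎 I)
  (sat : Interpretation.SatisfiesRules I cf M) where

  open Rules {I} {cf} {M} ⟦⊥⟧ sat
  open Interpretation (double I) using () renaming
    ( Carrier to Carrier²; booleanAlgebra to booleanAlgebra²; _⋎_ to _⋎²_; _⋏_ to _⋏²_
    ; ∼_ to ∼²_; 𝟏 to 𝟏²; 𝟎 to 𝟎²; ⟦_⟧ to ⟦_⟧²; _≟_ to _≟²_)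
  module B where
    open BooleanAlgebraProperties booleanAlgebra² public
    open BooleanAlgebra booleanAlgebra² public using (∨-comm; ∨-complementˡ)
  open Extend {X = For} _≟²_
  open Extend {X = For} _≟_ using () renaming (locate to locate₁)

  private variable
    α β γ : For
    a : Carrier²

  diag : Carrier → Carrier²
  diag x = x , x

  -- The first coordinate determines `⟦¬α⟧`, so distinct values never share a lift. The second
  -- ensures that a lift equal to a diagonal pair `(c, c)` has `c = ⟦¬¬α⟧`, where cf at `¬α`
  -- controls the negation.
  lift : For → Carrier²
  lift α = ∼ ⟦ ¬̇ α ⟧ , ⟦ ¬̇ ¬̇ α ⟧

  New : For → Set
  New α = ∀ {γ} → γ ∈ M → ⟦ γ ⟧ ≢ ⟦ ¬̇ α ⟧

  new? : ∀ α → Dec (New α)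
  new? α with locate₁ ⟦_⟧ M ⟦ ¬̇ α ⟧
  ... | inj₁ (γ , γ∈ , p) = no λ new → new γ∈ p
  ... | inj₂ new = yes new

  -- Negation on the square, in order of precedence: (a, a) ↦ (⟦¬α⟧, ⟦¬α⟧) for
  -- a = ⟦α⟧; (b, b) ↦ (∼b, ⟦¬¬α⟧) for b = ⟦¬α⟧; (∼b, ⟦¬¬α⟧) ↦ (b, b) for those b
  -- that are not themselves values of M; and everything else ↦ (1, 1).
  M-new : List For
  M-new = filter new? M

  N₁ N₂ N : Op₁ Carrier²
  N₂ = extend lift (⟦_⟧² ∘ ¬̇_) M-new (λ _ → 𝟏²)
  N₁ = extend (⟦_⟧² ∘ ¬̇_) lift M N₂
  N  = extend ⟦_⟧² (⟦_⟧² ∘ ¬̇_) M N₁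

  C : Op₁ Carrier²
  -- Off the values of `M`, `𝟎²` satisfies `C-law` whatever `N` is, and cf imposes nothing on `∘̇`.
  C = extend ⟦_⟧² (⟦_⟧² ∘ ∘̇_) M (λ _ → 𝟎²)

  lift-injective : lift γ ≡ lift α → ⟦ ¬̇ γ ⟧ ≡ ⟦ ¬̇ α ⟧
  lift-injective p =
    trans (sym (¬-involutive _)) (trans (cong (∼_ ∘ proj₁) p) (¬-involutive _))

  lift-respects : α ∈ M → γ ∈ M → ⟦ ¬̇ γ ⟧ ≡ ⟦ ¬̇ α ⟧ → lift γ ≡ lift α
  lift-respects α∈ γ∈ p with _ ∷ _ ∷ r ∷ _ ← specific α∈ γ∈ = cong₂ (λ x y → ∼ x , y) p (r p)

  N-agrees : α ∈ M → N ⟦ α ⟧² ≡ ⟦ ¬̇ α ⟧²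
  N-agrees α∈ = extend-∈ α∈ λ γ∈ p → cong diag (¬-respects α∈ γ∈ (cong proj₁ p))

  N-agrees′ : α ∈ M → ⟦ α ⟧² ≡ a → N a ≡ ⟦ ¬̇ α ⟧²
  N-agrees′ α∈ refl = N-agrees α∈

  C-agrees : α ∈ M → C ⟦ α ⟧² ≡ ⟦ ∘̇ α ⟧²
  C-agrees α∈ = extend-∈ α∈ λ γ∈ p → cong diag (∘-respects α∈ γ∈ (cong proj₁ p))

  N-new : α ∈ M → New α → N ⟦ ¬̇ α ⟧² ≡ lift α
  N-new α∈ new = trans (extend-∉ λ γ∈ p → new γ∈ (cong proj₁ p))
    (extend-∈ α∈ λ γ∈ p → lift-respects α∈ γ∈ (cong proj₁ p))

  data View (a : Carrier²) : Set where
    old     : α ∈ M → ⟦ α ⟧² ≡ a → N a ≡ ⟦ ¬̇ α ⟧² → View a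
    new     : α ∈ M → New α → ⟦ ¬̇ α ⟧² ≡ a → N a ≡ lift α → View a
    lifted  : α ∈ M → New α → lift α ≡ a → N a ≡ ⟦ ¬̇ α ⟧² → View a
    default : (∀ {α} → α ∈ M → New α → lift α ≢ a) → N a ≡ 𝟏² → View a

  view : ∀ a → View a
  view a with locate ⟦_⟧² M a
  ... | inj₁ (α , α∈ , refl) = old α∈ refl (N-agrees α∈)
  ... | inj₂ a∉ with locate (⟦_⟧² ∘ ¬̇_) M a
  ...   | inj₁ (α , α∈ , refl) = new α∈ new-α refl (N-new α∈ new-α)
    where
    new-α : New α
    new-α γ∈ p = a∉ γ∈ (cong diag p)
  ...   | inj₂ a∉′ with locate lift M-new a
  ...     | inj₁ (α , α∈′ , refl) with α∈ , new-α ← ∈-filter⁻ new? {xs = M} α∈′ =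
    lifted α∈ new-α refl (trans (extend-∉ a∉) (trans (extend-∉ a∉′)
      (extend-∈ α∈′ λ _ p → cong diag (lift-injective p))))
  ...     | inj₂ a∉″ = default (λ α∈ new-α → a∉″ (∈-filter⁺ new? α∈ new-α))
    (trans (extend-∉ a∉) (trans (extend-∉ a∉′) (extend-∉ a∉″)))

  em-¬ : α ∈ M → ⟦ ¬̇ α ⟧ ⋎ ⟦ ¬̇ ¬̇ α ⟧ ≡ 𝟏
  em-¬ α∈ with _ ∷ r ∷ _ ← specific α∈ α∈ = covers (r refl)

  em-lift : α ∈ M → ⟦ ¬̇ α ⟧² ⋎² lift α ≡ 𝟏²
  em-lift α∈ = cong₂ _,_ (∨-complementʳ _) (em-¬ α∈)

  N-em : ∀ a → a ⋎² N a ≡ 𝟏²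
  N-em a with view a
  ... | old α∈ refl q rewrite q = cong diag (em-value α∈)
  ... | new α∈ _ refl q rewrite q = em-lift α∈
  ... | lifted {α} α∈ _ refl q rewrite q = trans (B.∨-comm (lift α) ⟦ ¬̇ α ⟧²) (em-lift α∈)
  ... | default _ q rewrite q = B.∨-zeroʳ a

  C-law : ∀ a → (a ⋏² N a) ⋏² C a ≡ 𝟎²
  C-law a with locate ⟦_⟧² M a
  ... | inj₁ (α , α∈ , refl) rewrite N-agrees α∈ | C-agrees α∈ = cong diag (bc-value α∈)
  ... | inj₂ a∉ = trans (cong ((a ⋏² N a) ⋏²_) (extend-∉ a∉)) (B.∧-zeroʳ (a ⋏² N a))

  infix 4 _⊑_ _⊑²_

  _⊑_ : Carrier → Carrier → Set
  x ⊑ y = ∼ x ⋎ y ≡ 𝟏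

  _⊑²_ : Carrier² → Carrier² → Set
  a ⊑² b = ∼² a ⋎² b ≡ 𝟏²

  ⊑²-reflexive : ∀ {a b} → a ≡ b → a ⊑² b
  ⊑²-reflexive {a} refl = B.∨-complementˡ a

  -- Makes the default `𝟏²` safe: applying `N` once more gives `𝟎²`, which lies below every `a`.
  N-𝟏 : N 𝟏² ≡ 𝟎²
  N-𝟏 with r ∷ _ ← specific ⊤∈M ⊤∈M =
    trans (N-agrees′ ⊤∈M (cong diag ⟦⊤⟧)) (cong diag (trans (r refl) ⟦⊥⟧))

  -- A lift may collide with a value handled by an earlier clause of `N`; reading the collision in
  -- the second coordinate brings in cf at `¬α`. Otherwise injectivity returns exactly `⟦¬α⟧²`.
  N-lift : α ∈ M → New α → N (lift α) ⊑² ⟦ ¬̇ α ⟧²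
  N-lift {α} α∈ new-α with view (lift α)
  ... | old γ∈ p q with _ ∷ _ ∷ _ ∷ _ ∷ _ ∷ r ∷ _ ← specific α∈ γ∈ rewrite q =
    cong diag (implies (r (cong proj₂ p)))
  ... | new {γ} γ∈ _ p q with _ ∷ _ ∷ _ ∷ _ ∷ _ ∷ _ ∷ r ∷ [] ← specific α∈ γ∈ rewrite q =
    cong₂ _,_ below (implies (r (cong proj₂ p)))
    where
    below : ∼ ⟦ ¬̇ γ ⟧ ⊑ ⟦ ¬̇ α ⟧
    below = trans (cong (λ x → ∼ ∼ x ⋎ ⟦ ¬̇ α ⟧) (cong proj₁ p))
      (trans (cong (_⋎ ⟦ ¬̇ α ⟧) (¬-involutive _)) (∨-complementˡ _))
  ... | lifted _ _ p q = ⊑²-reflexive (trans q (cong diag (lift-injective p)))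
  ... | default ∉ _ = contradiction refl (∉ α∈ new-α)

  schema : ∀ a → N (N a) ⊑² a
  schema a with view a
  ... | old {α} α∈ refl q rewrite q with locate₁ ⟦_⟧ M ⟦ ¬̇ α ⟧
  ...   | inj₁ (γ , γ∈ , p) with _ ∷ _ ∷ _ ∷ r ∷ _ ← specific α∈ γ∈
    rewrite N-agrees′ γ∈ (cong diag p) = cong diag (implies (r p))
  -- The coordinates use different reasons: `∼ ⟦¬α⟧` lies below `⟦α⟧` by excluded middle, `⟦¬¬α⟧` by
  -- cf.
  ...   | inj₂ new-α with _ ∷ _ ∷ _ ∷ _ ∷ r ∷ _ ← specific α∈ α∈ rewrite N-new α∈ new-α =
    cong₂ _,_ below (implies (r refl))
    where
    below : ∼ ⟦ ¬̇ α ⟧ ⊑ ⟦ α ⟧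
    below = trans (cong (_⋎ ⟦ α ⟧) (¬-involutive _)) (trans (∨-comm _ _) (em-value α∈))
  schema a | new α∈ new-α refl q rewrite q = N-lift α∈ new-α
  schema a | lifted α∈ new-α refl q = ⊑²-reflexive (trans (cong N q) (N-new α∈ new-α))
  schema a | default _ q =
    trans (cong (λ b → ∼² b ⋎² a) (trans (cong N q) N-𝟏))
      (trans (cong (_⋎² a) B.¬⊥≈⊤) (B.∨-zeroˡ a))

  completion : Completion (double I) cf M
  completion = record
    { N = N ; C = C ; N-em = N-em ; C-law = C-law ; schema = schema
    ; N-agrees = N-agrees ; C-agrees = C-agrees }

-- From suitable values to a finite refuting BALFI.

refute : ∀ I Ax {M φ} → Interpretation.Countermodel I Ax M φ → sub φ ⊆ M → ⊤̇ ∈ M →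
  Refutation Ax φ
refute I Ax {M} {φ} (⟦⊥⟧ , sat , ⟦φ⟧≢⟦⊤⟧) φ⊆M ⊤∈M = by-completion Ax sat
  where
  open Interpretation I

  ⟦φ⟧≢𝟏 : ⟦ φ ⟧ ≢ 𝟏
  ⟦φ⟧≢𝟏 p = ⟦φ⟧≢⟦⊤⟧ (trans p (sym (Rules.⟦⊤⟧ {I} {Ax} {M} ⟦⊥⟧ sat)))

  classically : ∀ Ax → Ax ≢ cf → SatisfiesRules Ax M → Refutation Ax φ
  classically Ax ≢cf sat =
    CompletedModel.refutation (ClassicalDefault.completion ⟦⊥⟧ sat ≢cf) φ⊆M ⟦φ⟧≢𝟏

  by-completion : ∀ Ax → SatisfiesRules Ax M → Refutation Ax φ
  by-completion ciw = classically ciw λ ()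
  by-completion ci  = classically ci λ ()
  by-completion cl  = classically cl λ ()
  by-completion cf sat =
    CompletedModel.refutation (Doubled.completion ⊤∈M ⟦⊥⟧ sat) φ⊆M (⟦φ⟧≢𝟏 ∘ cong proj₁)
  by-completion d1  = classically d1 λ ()
  by-completion d2  = classically d2 λ ()
  by-completion a∘  = classically a∘ λ ()

theorem5p4 : (Ax : Schema) (φ : For) → ¬ (RmbC[ Ax ]⊢ φ) →
    Σ (BALFI 0ℓ 0ℓ) λ A → Finite A × BI Ax A ×
    Σ (Valuation A) λ v → ¬ (BALFI._≈_ A (value v φ) (BALFI.⊤ A))
-- `M` is the list of subformulas of `φ ∧̇ ⊤̇`: it contains those of `φ`, and also `⊤̇`, on which
-- the negation of 1 in the cf case depends.
theorem5p4 Ax φ ⊬φ = refute _ Ax (proj₂ countermodel) φ⊆ (⊤⊆ (self∈sub ⊤̇))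
  where
  φ⊆ : sub φ ⊆ sub (φ ∧̇ ⊤̇)
  φ⊆ = there ∘ ∈-++⁺ˡ

  ⊤⊆ : sub ⊤̇ ⊆ sub (φ ∧̇ ⊤̇)
  ⊤⊆ = there ∘ ∈-++⁺ʳ (sub φ)

  countermodel : ∃ λ ws → Interpretation.Countermodel (worldsInterpretation ws) Ax _ φ
  countermodel = countermodel-exists Ax (all-over (φ ∧̇ ⊤̇) id)
    (over ⊥̇ (⊤⊆ ∘ there ∘ ∈-++⁺ˡ)) (over φ φ⊆) ⊬φ
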